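{- Let $\mathcal D\subseteq\mathcal C$ be a $\le$-amalgamation class with $T\in\mathcal D$. Then $\mathcal D=\mathcal C$ or $\mathcal D=\mathcal C_n$ for some $n\ge2$.
   Context: Subdigraph means full induced subdigraph. For $s\ge0$ an $s$-arc from $u_0$ to $u_s$ is a sequence $u_0\ldots u_s$ with $(u_i,u_{i+1})$ edges and $u_{i-1}\ne u_{i+1}$ for $0<i<s$; ${\rm desc}(u)$ is the set of vertices reachable from $u$ by an $s$-arc for some $s\ge0$, ${\rm desc}(X)=\bigcup_{x\in X}{\rm desc}(x)$. $A\le D$ means $A$ is a descendant-closed subdigraph of $D$; it is finitely generated if $A={\rm desc}_D(F)$ for a finite $F$. A $\le$-embedding $f:A\to B$ is an embedding with $f(A)\le B$; $f_i:A\to B_i$ are isomorphic if $f_2=h\circ f_1$ for an isomorphism $h:B_1\to B_2$. Fix $q\ge2$; $T$ is the $q$-valent rooted tree (finite sequences over $\{0,\ldots,q-1\}$, edges $(\bar w,\bar wi)$). $\mathcal C$ is the class of digraphs $A$ with ${\rm desc}(a)\cong T$ for all $a\in A$, $A$ finitely generated, and ${\rm desc}(a)\cap{\rm desc}(b)$ finitely generated for all $a,b\in A$. For $n\ge2$, $\mathcal T_n$ is obtained from $T$ by deleting the root and adding $n$ vertices $x_1,\ldots,x_n$ each with edges to all $q$ children of the deleted root; $\mathcal C_n$ is the class of $A\in\mathcal C$ into which $\mathcal T_n$ does not embed as a descendant-closed subdigraph. A $\le$-amalgamation class is a class $\mathcal D$ of digraphs such that: (1) its members are countable and finitely generated, it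 is closed under isomorphism, and it has countably many isomorphism types; (2) it is closed under finitely generated descendant-closed subdigraphs; (3) for $A,B_1,B_2\in\mathcal D$ and $\le$-embeddings $f_i:A\to B_i$ there are $C\in\mathcal D$ and $\le$-embeddings $g_i:B_i\to C$ with $g_1\circ f_1=g_2\circ f_2$; (4) for $A,B\in\mathcal D$ there are only countably many isomorphism types of $\le$-embeddings $A\to B$. -}

module Defs where

open import Level using (Level)
open import Data.Nat using (ℕ; zero; suc; _≤_)
open import Data.Fin using (Fin)
open import Data.List using (List; []; _∷_; _++_; [_])
open import Data.List.Relation.Unary.Any using (Any)
open import Data.Unit using (⊤)
open import Data.Product using (Σ; ∃; _×_; _,_; proj₁)
open import Data.Sum using (_⊎_; inj₁; inj₂)
open import Relation.Binary.PropositionalEquality using (_≡_; _≢_)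
open import Relation.Nullary using (¬_)
open import Function.Bundles using (_⇔_)

record Digraph : Set₁ where
  field
    V : Set
    E : V → V → Set
open Digraph public

Inj : {X Y : Set} → (X → Y) → Set
Inj f = ∀ {x y} → f x ≡ f y → x ≡ y

module _ (D : Digraph) where

  record Arc (x y : V D) : Set where
    field
      len     : ℕ
      path    : ℕ → V D
      start   : path 0 ≡ x
      end     : path len ≡ y
      edges   : ∀ i → suc i ≤ len → E D (path i) (path (suc i))
      nonback : ∀ i → suc (suc i) ≤ len → path i ≢ path (suc (suc i))

  Desc : V D → V D → Set
  Desc x y = Arc x y

  DescClosed : (V D → Set) → Set
  DescClosed S = ∀ x y → S x → Desc x y → S y

  GeneratedBy : (V D → Set) → List (V D) → Set
  GeneratedBy S F = ∀ v → S v ⇔ Any (λ x → Desc x v) F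

  FinGenSet : (V D → Set) → Set
  FinGenSet S = Σ (List (V D)) (GeneratedBy S)

  FinGen : Set
  FinGen = FinGenSet (λ _ → ⊤)

record Embedding (A B : Digraph) : Set where
  field
    fun  : V A → V B
    inj  : Inj fun
    edge : ∀ x y → E A x y ⇔ E B (fun x) (fun y)
open Embedding public

Image : {A B : Digraph} → Embedding A B → V B → Set
Image {A} e v = Σ (V A) λ a → fun e a ≡ v

record LeEmb (A B : Digraph) : Set where
  field
    emb    : Embedding A B
    closed : DescClosed B (Image emb)
open LeEmb public

record Iso (A B : Digraph) : Set where
  field
    emb  : Embedding A B
    surj : ∀ y → Image emb y
open Iso public

TreeEdge : (q : ℕ) → List (Fin q) → List (Fin q) → Set
TreeEdge q w w' = Σ (Fin q) λ i → w' ≡ w ++ [ i ]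

Tree : ℕ → Digraph
Tree q = record { V = List (Fin q) ; E = TreeEdge q }

DescIsoT : (q : ℕ) (A : Digraph) → V A → Set
DescIsoT q A a =
  Σ (List (Fin q) → V A) λ f →
    Inj f
    × (∀ v → Desc A a v ⇔ (Σ (List (Fin q)) λ w → f w ≡ v))
    × (∀ w w' → E A (f w) (f w') ⇔ TreeEdge q w w')

-- 𝒯_n : T with the root deleted and n new vertices x_1..x_n each joined to
-- the q children of the deleted root.  Non-root tree vertices are the
-- nonempty words i ∷ w, encoded as (i , w).
TnV : ℕ → ℕ → Set
TnV q n = Fin n ⊎ (Fin q × List (Fin q))

data TnE (q n : ℕ) : TnV q n → TnV q n → Set where
  root : ∀ x j → TnE q n (inj₁ x) (inj₂ (j , []))
  step : ∀ i w j → TnE q n (inj₂ (i , w)) (inj₂ (i , w ++ [ j ]))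

Tn : ℕ → ℕ → Digraph
Tn q n = record { V = TnV q n ; E = TnE q n }

C : ℕ → Digraph → Set
C q A =
  (∀ a → DescIsoT q A a)
  × FinGen A
  × (∀ a b → FinGenSet A (λ v → Desc A a v × Desc A b v))

Cn : ℕ → ℕ → Digraph → Set
Cn q n A = C q A × ¬ LeEmb (Tn q n) A

Class : Set₁
Class = Digraph → Set

record AmalgamationClass (D : Class) : Set₁ where
  field
    countable  : ∀ A → D A → Σ (V A → ℕ) Inj
    finGen     : ∀ A → D A → FinGen A
    isoClosed  : ∀ A B → D A → Iso A B → D B
    countTypes : Σ (Σ Digraph D → ℕ) λ c →
                   ∀ X Y → c X ≡ c Y → Iso (proj₁ X) (proj₁ Y)
    -- (2) closed under finitely generated descendant-closed subdigraphs:
    -- any B embedded onto such a subset S of A (i.e. B ≅ the induced subdigraph on S)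
    subClosed  : ∀ A → D A → (B : Digraph) (e : Embedding B A) →
                   DescClosed A (Image e) → FinGenSet A (Image e) → D B
    amalg      : ∀ A B₁ B₂ → D A → D B₁ → D B₂ →
                   (f₁ : LeEmb A B₁) (f₂ : LeEmb A B₂) →
                   Σ Digraph λ Cd → D Cd ×
                   Σ (LeEmb B₁ Cd) λ g₁ → Σ (LeEmb B₂ Cd) λ g₂ →
                     ∀ a → fun (emb g₁) (fun (emb f₁) a) ≡ fun (emb g₂) (fun (emb f₂) a)
    embTypes   : ∀ A B → D A → D B →
                   Σ (LeEmb A B → ℕ) λ c → ∀ f g → c f ≡ c g →
                   Σ (Iso B B) λ h → ∀ a → fun (emb g) a ≡ fun (Iso.emb h) (fun (emb f) a)

-- Since all cones desc(a) are copies of T, reachability makes A ∈ 𝒞 a free q-ary branching system,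
-- and since their intersections are finitely generated, all but finitely many vertices of A form a
-- finite disjoint union of copies of T, which lies in 𝒟 because it is a descendant-closed part of T.
-- The remaining vertices are added one at a time, children first.  To add x to B ≤ A with B ∈ 𝒟, let m
-- be the number of vertices of B with the same children as x.  Then 𝒯_{m+1} ≤ A, and if 𝒯_{m+1} ∈ 𝒟,
-- amalgamate it with B over the q trees below x: as B holds only m vertices with these children, some
-- top of 𝒯_{m+1} is not identified with a vertex of B, and B with this top is a copy of B ∪ {x}.
-- So A ∈ 𝒟 as soon as 𝒟 contains every 𝒯_k with 𝒯_k ≤ A, and 𝒟 is determined by the least n with
-- 𝒯_n ∉ 𝒟, if there is one.
module Submission where

open import Defs
open import Axiom.ExcludedMiddle using (ExcludedMiddle)
open import Level using (0ℓ)
open import Data.Nat using (ℕ; zero; suc; _+_; _≤_; _≤?_; _⊔_; z≤n; s≤s)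
open import Data.Nat.Properties using (<⇒≢; <⇒≱; ≤-refl; ≤-trans; ≤-reflexive; <⇒≤; m≤m⊔n; m≤n⊔m; ≰⇒>)
open import Data.Fin using (Fin; zero; suc; toℕ; inject≤)
open import Data.Fin.Properties using (toℕ-injective; pigeonhole; inject≤-injective)
open import Data.List using (List; []; _∷_; _++_; [_]; length; map; allFin; lookup; cartesianProductWith)
open import Data.List.Properties using (++-assoc; ++-identityʳ; ++-conicalˡ; ∷-injective; ∷-injectiveˡ; ∷ʳ-injectiveˡ)
open import Data.List.Membership.Propositional using (_∈_; find; lose)
open import Data.List.Membership.Propositional.Properties using (∈-lookup; ∈-allFin; ∈-cartesianProductWith⁺; ∈-cartesianProductWith⁻)
open import Data.List.Relation.Unary.Any as Any using (Any; here; there; satisfied; index)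
open import Data.List.Relation.Unary.Any.Properties using (map⁺; map⁻; lookup-index)
open import Data.List.Relation.Unary.All as All using (All; []; _∷_)
open import Data.List.Relation.Unary.AllPairs using (AllPairs; []; _∷_)
open import Data.Maybe using (Maybe; just; nothing; maybe′)
open import Data.Product using (Σ; ∃; _×_; _,_; proj₁; proj₂; map₂)
open import Data.Sum using (_⊎_; inj₁; inj₂)
open import Data.Sum.Properties using (inj₁-injective; inj₂-injective)
open import Data.Empty using (⊥-elim)
open import Data.Unit using (tt)
open import Function using (_∘_; id; case_of_)
open import Function.Bundles using (_⇔_; mk⇔; Equivalence)
open import Relation.Binary.Construct.Closure.ReflexiveTransitive using (Star; ε; _◅_; _◅◅_; gmap)
open import Relation.Binary.PropositionalEquality using (_≡_; _≢_; refl; sym; trans; cong; subst; subst₂)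
open import Relation.Nullary.Decidable using (decidable-stable)
open import Relation.Nullary using (¬_; yes; no; contradiction)

open Equivalence using (to; from)

-- Walks, forests of copies of T, and their generators

Reach : (A : Digraph) → V A → V A → Set
Reach A = Star (E A)

desc⇒reach : ∀ {A x y} → Desc A x y → Reach A x y
desc⇒reach {A} a = subst₂ (Reach A) start end (initial len ≤-refl)
  where
  open Arc a
  initial : ∀ i → i ≤ len → Reach A (path 0) (path i)
  initial zero    _     = ε
  initial (suc i) i<len = initial i (<⇒≤ i<len) ◅◅ (edges i i<len ◅ ε)

reach-closed : ∀ {A} {S : V A → Set} → (∀ {x y} → S x → E A x y → S y) →
  ∀ {x y} → S x → Reach A x y → S y
reach-closed cl s ε       = s
reach-closed cl s (e ◅ r) = reach-closed cl (cl s e) r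

Forest : ℕ → ℕ → Digraph
Forest q k = record
  { V = Fin k × List (Fin q)
  ; E = λ (i , w) (j , w′) → i ≡ j × TreeEdge q w w′
  }

forest-reach : ∀ {q k} i u w → Reach (Forest q k) (i , u) (i , u ++ w)
forest-reach i u []      = subst (λ v → Reach (Forest _ _) (i , u) (i , v)) (sym (++-identityʳ u)) ε
forest-reach i u (c ∷ w) = (refl , c , refl) ◅
  subst (λ v → Reach (Forest _ _) (i , u ++ [ c ]) (i , v)) (++-assoc u [ c ] w)
    (forest-reach i (u ++ [ c ]) w)

forest-generators : ∀ {q k} (v : V (Forest q k)) →
  Any (λ g → Reach (Forest q k) g v) (map (_, []) (allFin k))
forest-generators (i , w) = map⁺ (lose (∈-allFin i) (forest-reach i [] w))

Tn-reach : ∀ {q n} i u w → Reach (Tn q n) (inj₂ (i , u)) (inj₂ (i , u ++ w))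
Tn-reach i u w = gmap inj₂ (λ { {i , w} (refl , c , refl) → step i w c }) (forest-reach {k = _} i u w)

Tn-generators : ∀ {q m} (v : V (Tn q (suc m))) →
  Any (λ g → Reach (Tn q (suc m)) g v) (map inj₁ (allFin (suc m)))
Tn-generators (inj₁ i)       = map⁺ (lose (∈-allFin i) ε)
Tn-generators (inj₂ (j , w)) = map⁺ (lose (∈-allFin zero) (root zero j ◅ Tn-reach j [] w))

-- Words, uniform bounds and a discrete threshold

++-prefix : ∀ {X : Set} {u w u′ w′ : List X} → length w ≤ length u →
  u ++ u′ ≡ w ++ w′ → ∃ λ t → u ≡ w ++ t
++-prefix {w = []}              _         _  = _ , refl
++-prefix {u = _ ∷ u} {w = _ ∷ w} (s≤s le) eq with ∷-injective eq
... | refl , eq′ with ++-prefix {u = u} {w} le eq′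
... | t , refl = t , refl

words : ∀ q → ℕ → List (List (Fin q))
words q zero    = [ [] ]
words q (suc d) = cartesianProductWith _∷_ (allFin q) (words q d)

∈-words : ∀ {q} (u : List (Fin q)) → u ∈ words q (length u)
∈-words []      = here refl
∈-words (i ∷ u) = ∈-cartesianProductWith⁺ _∷_ (∈-allFin i) (∈-words u)

words-length : ∀ {q} d {u} → u ∈ words q d → length u ≡ d
words-length zero    (here refl) = refl
words-length {q} (suc d) u∈
  with _ , _ , _ , w∈ , refl ← ∈-cartesianProductWith⁻ _∷_ (allFin q) (words q d) u∈
  = cong suc (words-length d w∈)

common-bound : {X : Set} {P : X → ℕ → Set} → (∀ {x m n} → m ≤ n → P x m → P x n) →
  ∀ L → (∀ x → ∃ (P x)) → ∃ λ d → All (λ x → P x d) L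
common-bound mono []      h = 0 , []
common-bound mono (x ∷ L) h
  with m , p ← h x
  with n , ps ← common-bound mono L h
  = m ⊔ n , mono (m≤m⊔n m n) p ∷ All.map (mono (m≤n⊔m m n)) ps

-- The search goes down from the failure at `N`. It serves twice: for the number of twins already
-- present in a part, and for the threshold n of the classification.
last-true : {P : ℕ → Set} → ExcludedMiddle 0ℓ → P 0 → ∀ N → ¬ P N → ∃ λ m → P m × ¬ P (suc m)
last-true em p zero    ¬p = contradiction p ¬p
last-true {P} em p (suc N) ¬p with em {P N}
... | yes pN = N , pN , ¬p
... | no ¬pN = last-true em p N ¬pN

-- Arcs versus walks, and closed embeddings

module Classical (em : ExcludedMiddle 0ℓ) where

  -- Only the condition at the old start can fail, namely when `x` is already the second vertex of
  -- the arc; then the arc without its first vertex runs from `x` to `z`. Hence arcs and walks reach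
  -- the same vertices in any digraph. The guard `1 ≤ len` is there because `path` takes arbitrary
  -- values beyond `len`.
  prepend : ∀ {A x y z} → E A x y → Desc A y z → Desc A x z
  prepend {A} {x} {y} {z} e a@record { len = len ; path = path ; start = refl }
    with em {1 ≤ len × x ≡ path 1}
  ... | no ¬back = record
    { len     = suc len
    ; path    = λ { zero → x ; (suc i) → path i }
    ; start   = refl
    ; end     = Arc.end a
    ; edges   = λ { zero _ → e ; (suc i) (s≤s h) → Arc.edges a i h }
    ; nonback = λ { zero (s≤s h) eq → ¬back (h , eq) ; (suc i) (s≤s h) → Arc.nonback a i h }
    }
  prepend e a@record { len = suc n ; path = path ; start = refl } | yes (_ , refl) = record
    { len     = n
    ; path    = path ∘ suc
    ; start   = refl
    ; end     = Arc.end a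
    ; edges   = λ i h → Arc.edges a (suc i) (s≤s h)
    ; nonback = λ i h → Arc.nonback a (suc i) (s≤s h)
    }

  reach⇒desc : ∀ {A x y} → Reach A x y → Desc A x y
  reach⇒desc {x = x} ε = record
    { len = 0 ; path = λ _ → x ; start = refl ; end = refl
    ; edges = λ _ () ; nonback = λ _ () }
  reach⇒desc (e ◅ r) = prepend e (reach⇒desc r)

  mkLeEmb : ∀ {A B} (f : Embedding A B) → (∀ {a y} → E B (fun f a) y → Image f y) → LeEmb A B
  mkLeEmb f cl = record
    { emb = f
    ; closed = λ _ _ s d → reach-closed (λ { (_ , refl) e → cl e }) s (desc⇒reach d) }

  leEmb-id : ∀ {A} → LeEmb A A
  leEmb-id = mkLeEmb record { fun = id ; inj = id ; edge = λ _ _ → mk⇔ id id } λ {_} {y} _ → y , refl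

  module _ {A B : Digraph} (f : LeEmb A B) where

    image-closed : ∀ {v w} → Image (emb f) v → Reach B v w → Image (emb f) w
    image-closed s r = closed f _ _ s (reach⇒desc r)

    image-edge : ∀ {v w} → Image (emb f) v → E B v w → Image (emb f) w
    image-edge s e = image-closed s (e ◅ ε)

    map-reach : ∀ {x y} → Reach A x y → Reach B (fun (emb f) x) (fun (emb f) y)
    map-reach = gmap _ (λ {x y} → to (edge (emb f) x y))

  factor : ∀ {X A B} (h : LeEmb X A) (e : LeEmb B A) →
    (∀ x → Image (emb e) (fun (emb h) x)) →
    Σ (LeEmb X B) λ f → ∀ x → fun (emb e) (fun (emb f) x) ≡ fun (emb h) x
  factor {X} {A} {B} h e im = mkLeEmb record
      { fun  = f
      ; inj  = λ {x} {y} eq → inj (emb h) (trans (sym (ef x)) (trans (cong (fun (emb e)) eq) (ef y)))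
      ; edge = λ x y → mk⇔
          (λ xy → from (edge (emb e) _ _) (subst₂ (E A) (sym (ef x)) (sym (ef y)) (to (edge (emb h) x y) xy)))
          (λ xy → from (edge (emb h) x y) (subst₂ (E A) (ef x) (ef y) (to (edge (emb e) _ _) xy)))
      } cl , ef
    where
    f : V X → V B
    f x = proj₁ (im x)
    ef : ∀ x → fun (emb e) (f x) ≡ fun (emb h) x
    ef x = proj₂ (im x)
    cl : ∀ {x b} → E B (f x) b → Σ (V X) λ x′ → f x′ ≡ b
    cl {x} {b} fxb
      with x′ , eq ← image-edge h (x , sym (ef x)) (to (edge (emb e) _ _) fxb)
      = x′ , inj (emb e) (trans (ef x′) eq)

  Tn-children : ∀ {q n A} (f : LeEmb (Tn q n) A) i {y} →
    E A (fun (emb f) (inj₁ i)) y ⇔ (∃ λ j → fun (emb f) (inj₂ (j , [])) ≡ y)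
  Tn-children {A = A} f i = mk⇔ fwd λ { (j , refl) → to (edge (emb f) _ _) (root i j) }
    where
    fwd : ∀ {y} → E A (fun (emb f) (inj₁ i)) y → ∃ λ j → fun (emb f) (inj₂ (j , [])) ≡ y
    fwd e with image-edge f (inj₁ i , refl) e
    ... | v , refl with v | from (edge (emb f) _ _) e
    ... | _ | root _ j = j , refl

  -- Cones as free q-ary trees

  module Branching (q : ℕ) (A : Digraph) (tr : ∀ a → DescIsoT q A a) where

    label : V A → List (Fin q) → V A
    label a = proj₁ (tr a)

    label-injective : ∀ a → Inj (label a)
    label-injective a = proj₁ (proj₂ (tr a))

    label-surjective : ∀ {a v} → Reach A a v → ∃ λ w → label a w ≡ v
    label-surjective {a} r = to (proj₁ (proj₂ (proj₂ (tr a))) _) (reach⇒desc r)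

    label-edge : ∀ a w w′ → E A (label a w) (label a w′) ⇔ TreeEdge q w w′
    label-edge a = proj₂ (proj₂ (proj₂ (tr a)))

    -- Each step of the walk stays in the cone of `a`, so its end has a label, and an edge of T
    -- appends one letter.
    label-reach : ∀ a w {v} → Reach A (label a w) v → ∃ λ u → label a (w ++ u) ≡ v
    label-reach a w ε = [] , cong (label a) (++-identityʳ w)
    label-reach a w (e ◅ r)
      with w′ , refl ← label-surjective
             (desc⇒reach (from (proj₁ (proj₂ (proj₂ (tr a))) _) (w , refl)) ◅◅ (e ◅ ε))
      with i , refl ← to (label-edge a w w′) e
      with u , refl ← label-reach a (w ++ [ i ]) r
      = i ∷ u , cong (label a) (sym (++-assoc w [ i ] u))

    -- That the root goes to `a` has to be derived: `a` has some label `w`, and `label a []` lies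
    -- below `a`, so `w` is a prefix of the empty word.
    label-[] : ∀ a → label a [] ≡ a
    label-[] a
      with w , eq ← label-surjective {a} ε
      with u , eq′ ← label-reach a w
             (subst (λ x → Reach A x (label a [])) (sym eq)
               (desc⇒reach (from (proj₁ (proj₂ (proj₂ (tr a))) _) ([] , refl))))
      = subst (λ w → label a w ≡ a) (++-conicalˡ w u (label-injective a eq′)) eq

    child : V A → Fin q → V A
    child a i = label a [ i ]

    child-edge : ∀ a i → E A a (child a i)
    child-edge a i = subst (λ x → E A x (child a i)) (label-[] a) (from (label-edge a [] [ i ]) (i , refl))

    edge⇒child : ∀ {a y} → E A a y → ∃ λ i → child a i ≡ y
    edge⇒child {a} e
      with w , refl ← label-surjective (e ◅ ε)
      with i , refl ← to (label-edge a [] w) (subst (λ x → E A x (label a w)) (sym (label-[] a)) e)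
      = i , refl

    -- The labellings of different vertices are unrelated. Choosing the next child by the labelling
    -- of the current vertex makes words compose, as in `act-++`.
    act : V A → List (Fin q) → V A
    act a []      = a
    act a (i ∷ w) = act (child a i) w

    act-++ : ∀ a u w → act a (u ++ w) ≡ act (act a u) w
    act-++ a []      w = refl
    act-++ a (i ∷ u) w = act-++ (child a i) u w

    act-reach : ∀ a w → Reach A a (act a w)
    act-reach a []      = ε
    act-reach a (i ∷ w) = child-edge a i ◅ act-reach (child a i) w

    reach⇒act : ∀ {a v} → Reach A a v → ∃ λ w → act a w ≡ v
    reach⇒act ε = [] , refl
    reach⇒act (e ◅ r)
      with i , refl ← edge⇒child e
      with w , refl ← reach⇒act r
      = i ∷ w , refl

    act-child : ∀ a u i → act a (u ++ [ i ]) ≡ child (act a u) i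
    act-child a u i = act-++ a u [ i ]

    -- Everything below `child a i` has a word beginning with `i` as its `label a`, so the endpoint
    -- determines the first letter, and whether there is one.
    act-injective : ∀ a u w → act a u ≡ act a w → u ≡ w
    act-injective a [] [] _ = refl
    act-injective a [] (j ∷ w) eq
      with t , eq′ ← label-reach a [ j ] (act-reach (child a j) w)
      with () ← label-injective a (trans (label-[] a) (trans eq (sym eq′)))
    act-injective a (i ∷ u) [] eq
      with t , eq′ ← label-reach a [ i ] (act-reach (child a i) u)
      with () ← label-injective a (trans eq′ (trans eq (sym (label-[] a))))
    act-injective a (i ∷ u) (j ∷ w) eq
      with t , eq₁ ← label-reach a [ i ] (act-reach (child a i) u)
      with s , eq₂ ← label-reach a [ j ] (act-reach (child a j) w)
      with refl ← ∷-injectiveˡ (label-injective a (trans eq₁ (trans eq (sym eq₂))))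
      = cong (i ∷_) (act-injective (child a i) u w eq)

    act-edge : ∀ a u w → E A (act a u) (act a w) ⇔ TreeEdge q u w
    act-edge a u w = mk⇔
      (λ e → let i , eq = edge⇒child e in
        i , sym (act-injective a (u ++ [ i ]) w (trans (act-child a u i) eq)))
      (λ { (i , refl) → subst (E A (act a u)) (sym (act-child a u i)) (child-edge (act a u) i) })

    -- The cone of `a` is a tree. Consequently distinct vertices with a common child never lie below
    -- the same generator.
    parent-unique : ∀ {a x y z} → Reach A a x → Reach A a y → E A x z → E A y z → x ≡ y
    parent-unique {a} r s e f
      with u , refl ← reach⇒act r
      with w , refl ← reach⇒act s
      with i , refl ← edge⇒child e
      with j , eq ← edge⇒child f
      = cong (act a) (∷ʳ-injectiveˡ u w (act-injective a (u ++ [ i ]) (w ++ [ j ])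
          (trans (act-child a u i) (trans (sym eq) (sym (act-child a w j))))))

    -- Twins, and embeddings of forests and of 𝒯_n

    Twin : V A → V A → Set
    Twin x y = ∀ {z} → E A x z ⇔ E A y z

    forestEmb : ∀ {k} (x : Fin k → V A) →
      (∀ {i j v} → Reach A (x i) v → Reach A (x j) v → i ≡ j) → LeEmb (Forest q k) A
    forestEmb x disjoint = mkLeEmb record
      { fun  = λ (i , w) → act (x i) w
      ; inj  = λ {(i , u)} {(j , w)} → injective i j u w
      ; edge = λ (i , u) (j , w) → mk⇔
          (λ { (refl , t) → from (act-edge (x i) u w) t })
          (reflect i j u w)
      } λ { {(i , u)} e → let c , eq = edge⇒child e in (i , u ++ [ c ]) , trans (act-child (x i) u c) eq }
      where
      injective : ∀ i j u w → act (x i) u ≡ act (x j) w → (i , u) ≡ (j , w)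
      injective i j u w eq
        with refl ← disjoint (act-reach (x i) u) (subst (Reach A (x j)) (sym eq) (act-reach (x j) w))
        = cong (i ,_) (act-injective (x i) u w eq)
      reflect : ∀ i j u w → E A (act (x i) u) (act (x j) w) → i ≡ j × TreeEdge q u w
      reflect i j u w e
        with refl ← disjoint (act-reach (x i) u ◅◅ (e ◅ ε)) (act-reach (x j) w)
        = refl , to (act-edge (x i) u w) e

    module _ (c₀ : Fin q) {n : ℕ} (x : V A) (g : Fin n → V A) (g-inj : Inj g) (twins : ∀ i → Twin (g i) x) where

      private
        h : TnV q n → V A
        h (inj₁ i)       = g i
        h (inj₂ (j , w)) = act x (j ∷ w)

        twin-child : ∀ i {y} → E A (g i) y → ∃ λ c → child x c ≡ y
        twin-child i e = edge⇒child (to (twins i) e)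

        -- A child of a twin has depth one below `x`, whereas a child of a vertex strictly below `x`
        -- has depth at least two.
        twin≢below : ∀ i j w → g i ≢ act x (j ∷ w)
        twin≢below i j w eq
          with c , eq′ ← twin-child i (child-edge (g i) c₀)
          with t ← trans eq′ (trans (cong (λ y → child y c₀) eq) (sym (act-child x (j ∷ w) c₀)))
          with act-injective x [ c ] (j ∷ w ++ [ c₀ ]) t
        twin≢below i j [] eq | ()
        twin≢below i j (_ ∷ _) eq | ()

        h-inj : ∀ u v → h u ≡ h v → u ≡ v
        h-inj (inj₁ i) (inj₁ j) eq = cong inj₁ (g-inj eq)
        h-inj (inj₁ i) (inj₂ (j , w)) eq = ⊥-elim (twin≢below i j w eq)
        h-inj (inj₂ (j , w)) (inj₁ i) eq = ⊥-elim (twin≢below i j w (sym eq))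
        h-inj (inj₂ (i , u)) (inj₂ (j , w)) eq with refl ← act-injective x (i ∷ u) (j ∷ w) eq = refl

        h-edge : ∀ {u v} → TnE q n u v → E A (h u) (h v)
        h-edge (root i j)   = from (twins i) (child-edge x j)
        h-edge (step i w j) = from (act-edge x (i ∷ w) (i ∷ w ++ [ j ])) (j , refl)

        h-reflect : ∀ u v → E A (h u) (h v) → TnE q n u v
        h-reflect (inj₁ i) (inj₁ j) e with c , eq ← twin-child i e = ⊥-elim (twin≢below j c [] (sym eq))
        h-reflect (inj₁ i) (inj₂ (j , w)) e
          with c , eq ← twin-child i e
          with refl ← act-injective x [ c ] (j ∷ w) eq = root i j
        h-reflect (inj₂ (j , w)) (inj₁ i) e
          with c , eq ← edge⇒child e
          = ⊥-elim (twin≢below i j (w ++ [ c ]) (trans (sym eq) (sym (act-child x (j ∷ w) c))))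
        h-reflect (inj₂ (i , u)) (inj₂ (j , w)) e
          with c , refl ← to (act-edge x (i ∷ u) (j ∷ w)) e = step i u c

        h-closed : ∀ u {y} → E A (h u) y → Σ (TnV q n) λ v → h v ≡ y
        h-closed (inj₁ i) e with c , eq ← twin-child i e = inj₂ (c , []) , eq
        h-closed (inj₂ (j , w)) e with c , eq ← edge⇒child e =
          inj₂ (j , w ++ [ c ]) , trans (act-child x (j ∷ w) c) eq

      -- Any n distinct vertices with the children of `x` serve as tops; `x` only provides the
      -- coordinates for the trees under them.
      TnEmb : LeEmb (Tn q n) A
      TnEmb = mkLeEmb record
        { fun = h ; inj = λ {u} {v} → h-inj u v ; edge = λ u v → mk⇔ h-edge (h-reflect u v) }
        λ {u} → h-closed u

    -- A finite family of disjoint cones near all generators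

    ⟨_⟩ : List (V A) → V A → Set
    ⟨ L ⟩ v = Any (λ x → Reach A x v) L

    ⟨⟩-closed : ∀ {L x y} → ⟨ L ⟩ x → Reach A x y → ⟨ L ⟩ y
    ⟨⟩-closed s r = Any.map (_◅◅ r) s

    Disjoint : V A → V A → Set
    Disjoint x y = ∀ {v} → Reach A x v → ¬ Reach A y v

    Independent : List (V A) → Set
    Independent = AllPairs Disjoint

    independent-lookup : ∀ {L} → Independent L → ∀ {i j v} →
      Reach A (lookup L i) v → Reach A (lookup L j) v → i ≡ j
    independent-lookup (_ ∷ _)  {zero}  {zero}  r s = refl
    independent-lookup (d ∷ _)  {zero}  {suc j} r s = ⊥-elim (All.lookup d (∈-lookup j) r s)
    independent-lookup (d ∷ _)  {suc i} {zero}  r s = ⊥-elim (All.lookup d (∈-lookup i) s r)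
    independent-lookup (_ ∷ ds) {suc i} {suc j} r s = cong suc (independent-lookup ds r s)

    -- For closed S: the cone below x is contained in S or disjoint from it.
    Laminar : (V A → Set) → V A → Set
    Laminar S x = ∀ {v} → Reach A x v → S v → S x

    -- A common descendant has a word extending both `w` and `u`, so the shorter of the two is a
    -- prefix of the other.
    level-laminar : ∀ a w u → length w ≤ length u → Laminar (Reach A (act a w)) (act a u)
    level-laminar a w u le r s
      with u′ , refl ← reach⇒act r
      with w′ , eq ← reach⇒act s
      with t , refl ← ++-prefix {u = u} {w} le
             (act-injective a (u ++ u′) (w ++ w′) (trans (act-++ a u u′) (trans (sym eq) (sym (act-++ a w w′)))))
      = subst (Reach A (act a w)) (sym (act-++ a w t)) (act-reach (act a w) t)

    -- Every path leaving x meets S after finitely many steps; the induction rebuilds x from S bottom-up.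
    data Near (S : V A → Set) (x : V A) : Set where
      here : S x → Near S x
      step : (∀ i → Near S (child x i)) → Near S x

    near-map : ∀ {S S′ x} → (∀ {v} → S v → S′ v) → Near S x → Near S′ x
    near-map f (here s) = here (f s)
    near-map f (step h) = step (λ i → near-map f (h i))

    level-near : ∀ {S} d a → (∀ u → length u ≡ d → S (act a u)) → Near S a
    level-near zero    a h = here (h [] refl)
    level-near (suc d) a h = step λ i → level-near d (child a i) λ u eq → h (i ∷ u) (cong suc eq)

    restrict : ∀ {m n} → Fin q → m ≤ n → LeEmb (Tn q (suc n)) A → LeEmb (Tn q (suc m)) A
    restrict c₀ m≤n f = TnEmb c₀ (fun (emb f) (inj₁ zero)) (λ i → fun (emb f) (inj₁ (inject≤ i (s≤s m≤n))))
      (λ eq → inject≤-injective _ _ _ _ (inj₁-injective (inj (emb f) eq)))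
      (λ i → mk⇔ (from (Tn-children f zero) ∘ to (Tn-children f _)) (from (Tn-children f _) ∘ to (Tn-children f zero)))

    module _ (intersections : ∀ a b → FinGenSet A (λ v → Desc A a v × Desc A b v)) where

      private
        Bounds : (V A → Set) → V A → ℕ → Set
        Bounds S a d = ∀ u → d ≤ length u → Laminar S (act a u)

        bounds-weaken : ∀ {S a m n} → m ≤ n → Bounds S a m → Bounds S a n
        bounds-weaken m≤n h u n≤u = h u (≤-trans m≤n n≤u)

      -- The depth of `g` below `a` works. Reachability is a premise inside the bound so that
      -- `common-bound` can run over a bare list of vertices.
      descendant-bound : ∀ a g → ∃ λ d → Reach A a g → Bounds (Reach A g) a d
      descendant-bound a g with em {Reach A a g}
      ... | no ¬r = 0 , λ r → contradiction r ¬r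
      ... | yes r with w , refl ← reach⇒act r = length w , λ _ u le → level-laminar a w u le

      -- Take a vertex below `a` at least as deep as all generators of the intersection of the two
      -- cones. If its cone meets that of `b`, the common vertex lies below some generator `g`; by
      -- `level-laminar` the deep vertex itself is below `g`, and so below `b`.
      cone-bound : ∀ a b → ∃ (Bounds (Reach A b) a)
      cone-bound a b
        with G , gen ← intersections a b
        with d , bounds ← common-bound {P = λ g d → Reach A a g → Bounds (Reach A g) a d}
               (λ m≤n h r → bounds-weaken m≤n (h r)) G (descendant-bound a)
        = d , λ u d≤u {v} r s →
            let r′   = act-reach a u ◅◅ r
                over = to (gen v) (reach⇒desc r′ , reach⇒desc s)
                g , g∈G , g→v = find over
                a→g , b→g = from (gen g) (Any.map (λ { refl → reach⇒desc ε }) g∈G)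
            in desc⇒reach b→g ◅◅ All.lookup bounds g∈G (desc⇒reach a→g) u d≤u r (desc⇒reach g→v)

      union-bound : ∀ a L → ∃ (Bounds ⟨ L ⟩ a)
      union-bound a L
        with d , bounds ← common-bound {P = λ b → Bounds (Reach A b) a} bounds-weaken L (cone-bound a)
        = d , λ u d≤u r s →
            let b , b∈L , b→v = find s in lose b∈L (All.lookup bounds b∈L u d≤u r b→v)

      -- If `act a u` is not in the set generated by `L`, laminarity makes its cone disjoint from
      -- that set, so it can join `L`. The remaining vertices stay laminar, since cones at the same
      -- level below `a` are equal or disjoint.
      grow : ∀ a d us → All (λ u → length u ≡ d) us → ∀ {L} → Independent L →
        (∀ u → length u ≡ d → Laminar ⟨ L ⟩ (act a u)) →
        ∃ λ L′ → Independent L′ × (∀ {v} → ⟨ L ⟩ v → ⟨ L′ ⟩ v) × All (λ u → ⟨ L′ ⟩ (act a u)) us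
      grow a d [] _ ind lam = _ , ind , id , []
      grow a d (u ∷ us) (u≡d ∷ us≡d) {L} ind lam with em {⟨ L ⟩ (act a u)}
      ... | yes s with L′ , ind′ , L⊆L′ , all ← grow a d us us≡d ind lam = L′ , ind′ , L⊆L′ , L⊆L′ s ∷ all
      ... | no ¬s
        with L′ , ind′ , L⊆L′ , all ← grow a d us us≡d
               {act a u ∷ L}
               (All.tabulate (λ y∈L r s → ¬s (lam u u≡d r (lose y∈L s))) ∷ ind)
               (λ u′ u′≡d r → λ
                 { (here s)  → here (level-laminar a u u′ (≤-reflexive (trans u≡d (sym u′≡d))) r s)
                 ; (there s) → there (lam u′ u′≡d r s) })
        = L′ , ind′ , L⊆L′ ∘ there , L⊆L′ (here ε) ∷ all

      -- For a new generator `a`, choose a level `d` below `a` from which on cones respect the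
      -- family found so far, and absorb that whole level. Only the finitely many words shorter than
      -- `d` are left above it.
      skeleton : ∀ F → ∃ λ L → Independent L × All (Near ⟨ L ⟩) F
      skeleton [] = [] , [] , []
      skeleton (a ∷ F)
        with L , ind , near ← skeleton F
        with d , bounds ← union-bound a L
        with L′ , ind′ , L⊆L′ , all ← grow a d (words q d) (All.tabulate (words-length d)) ind
               (λ u u≡d → bounds u (≤-reflexive (sym u≡d)))
        = L′ , ind′ , level-near d a (λ { u refl → All.lookup all (∈-words u) }) ∷ All.map (near-map L⊆L′) near

  -- Forests and 𝒯_1 in the class

  module Amalgamation (q : ℕ) (i₀ i₁ : Fin q) (i₀≢i₁ : i₀ ≢ i₁)
    (D : Class) (AC : AmalgamationClass D) (D⊆C : ∀ A → D A → C q A) (DT : D (Tree q)) where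

    open AmalgamationClass AC

    subdigraph∈D : ∀ {X A} → D A → LeEmb X A → (F : List (V X)) →
      (∀ v → Any (λ g → Reach X g v) F) → D X
    subdigraph∈D {X} {A} dA f F gen = subClosed A dA X (emb f) (closed f) (map (fun (emb f)) F , λ v → mk⇔
      (λ { (x , refl) → map⁺ (Any.map (reach⇒desc ∘ map-reach f) (gen x)) })
      (λ any → let g , d = satisfied (map⁻ any) in closed f _ _ (g , refl) d))

    Tn∈D : ∀ {A m} → D A → LeEmb (Tn q (suc m)) A → D (Tn q (suc m))
    Tn∈D dA f = subdigraph∈D dA f _ Tn-generators

    -- The root of T, as its own twin, is the single top.
    T₁∈D : D (Tn q 1)
    T₁∈D = Tn∈D DT (Branching.TnEmb q (Tree q) (proj₁ (D⊆C _ DT)) i₀ {1} [] (λ _ → [])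
      (λ { {zero} {zero} _ → refl }) (λ _ → mk⇔ id id))

    -- The words i₀ᵐ i₁ are pairwise incomparable, so T contains arbitrarily many disjoint copies of itself.
    stalk : ℕ → List (Fin q)
    stalk zero    = [ i₁ ]
    stalk (suc m) = i₀ ∷ stalk m

    stalk-injective : ∀ m n {u w} → stalk m ++ u ≡ stalk n ++ w → m ≡ n
    stalk-injective zero    zero    eq = refl
    stalk-injective zero    (suc n) eq = ⊥-elim (i₀≢i₁ (sym (∷-injectiveˡ eq)))
    stalk-injective (suc m) zero    eq = ⊥-elim (i₀≢i₁ (∷-injectiveˡ eq))
    stalk-injective (suc m) (suc n) eq = cong suc (stalk-injective m n (proj₂ (∷-injective eq)))

    Forest∈D : ∀ k → D (Forest q k)
    Forest∈D k = subdigraph∈D DT (T.forestEmb {k} (λ i → T.act [] (stalk (toℕ i))) disjoint) _ forest-generators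
      where
      module T = Branching q (Tree q) (proj₁ (D⊆C _ DT))
      disjoint : ∀ {i j v} → Reach (Tree q) (T.act [] (stalk (toℕ i))) v →
        Reach (Tree q) (T.act [] (stalk (toℕ j))) v → i ≡ j
      disjoint {i} {j} r s
        with u , refl ← T.reach⇒act r
        with w , eq ← T.reach⇒act s
        = toℕ-injective (stalk-injective _ _ (T.act-injective [] (stalk (toℕ i) ++ u) (stalk (toℕ j) ++ w)
            (trans (T.act-++ [] (stalk (toℕ i)) u) (trans (sym eq) (sym (T.act-++ [] (stalk (toℕ j)) w))))))

    -- These q trees are the base over which 𝒯_n is amalgamated with a part of A.
    Tn-lower : ∀ {n} → LeEmb (Forest q q) (Tn q n)
    Tn-lower = mkLeEmb record
      { fun  = inj₂
      ; inj  = inj₂-injective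
      ; edge = λ _ _ → mk⇔ (λ { (refl , c , refl) → step _ _ c }) (λ { (step _ _ c) → refl , c , refl })
      } λ { (step i w c) → (i , w ++ [ c ]) , refl }

    -- Rebuilding A inside the class, one vertex at a time

    module _ (A : Digraph) (cA : C q A)
      (Tn≤A⇒Tn∈D : ∀ m → LeEmb (Tn q (suc m)) A → D (Tn q (suc m))) where

      open Branching q A (proj₁ cA)

      generators : List (V A)
      generators = proj₁ (proj₁ (proj₂ cA))

      generated : ∀ v → ⟨ generators ⟩ v
      generated v = Any.map desc⇒reach (to (proj₂ (proj₁ (proj₂ cA)) v) tt)

      -- With more twins than generators, two of them lie below the same generator; they share the
      -- child `child x i₀`, against `parent-unique`.
      twins-bounded : ∀ {k} x (g : Fin k → V A) → Inj g → (∀ i → Twin (g i) x) → k ≤ length generators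
      twins-bounded {k} x g g-inj twins with k ≤? length generators
      ... | yes k≤ = k≤
      ... | no k≰
        with i , j , i<j , eq ← pigeonhole (≰⇒> k≰) (index ∘ generated ∘ g)
        = ⊥-elim (<⇒≢ i<j (cong toℕ (g-inj (parent-unique
            (lookup-index (generated (g i)))
            (subst (λ l → Reach A (lookup generators l) (g j)) (sym eq) (lookup-index (generated (g j))))
            (from (twins i) (child-edge x i₀))
            (from (twins j) (child-edge x i₀))))))

      -- A closed piece of A is kept as a digraph with an embedding, because membership in `D`
      -- concerns digraphs and not subsets.
      record Part : Set₁ where
        field
          {part} : Digraph
          part∈D : D part
          incl   : LeEmb part A
        Contains : V A → Set
        Contains = Image (emb incl)
      open Part

      _⊑_ : Part → Part → Set
      P ⊑ Q = ∀ {v} → Contains P v → Contains Q v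

      module AddVertex (P : Part) (x : V A) (x∉P : ¬ Contains P x) (children∈P : ∀ i → Contains P (child x i)) where

        private
          B = part P
          e = incl P

        TwinsInPart : ℕ → Set
        TwinsInPart k = Σ (Fin k → V B) λ g → Inj g × (∀ i → Twin (fun (emb e) (g i)) x)

        -- With m maximal, one of the m + 1 tops of 𝒯_{m+1} must stay outside B in every amalgam.
        maximal : ∃ λ m → TwinsInPart m × ¬ TwinsInPart (suc m)
        maximal = last-true em ((λ ()) , (λ { {()} }) , λ ()) (suc _)
          λ (g , g-inj , twins) → <⇒≱ ≤-refl (twins-bounded x _ (g-inj ∘ inj (emb e)) twins)

        suc-twins∈D : ∀ {m} → TwinsInPart m → D (Tn q (suc m))
        suc-twins∈D (g , g-inj , twins) = Tn≤A⇒Tn∈D _ (TnEmb i₀ x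
          (λ { zero → x ; (suc i) → fun (emb e) (g i) })
          (λ { {zero}  {zero}  _  → refl
             ; {zero}  {suc j} eq → ⊥-elim (x∉P (g j , sym eq))
             ; {suc i} {zero}  eq → ⊥-elim (x∉P (g i , eq))
             ; {suc i} {suc j} eq → cong suc (g-inj (inj (emb e) eq)) })
          (λ { zero → mk⇔ id id ; (suc i) → twins i }))

        lower : LeEmb (Forest q q) A
        lower = forestEmb (child x) λ {i} {j} r s →
          let u , eq = reach⇒act r ; w , eq′ = reach⇒act s in
          ∷-injectiveˡ (act-injective x (i ∷ u) (j ∷ w) (trans eq (sym eq′)))

        lower-in-part : ∀ v → Contains P (fun (emb lower) v)
        lower-in-part (i , w) = image-closed e (children∈P i) (act-reach (child x i) w)

        module Amalgam {m} (no-more-twins : ¬ TwinsInPart (suc m))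
          (f₁ : LeEmb (Forest q q) B) (e∘f₁ : ∀ v → fun (emb e) (fun (emb f₁) v) ≡ fun (emb lower) v)
          (K : Digraph) (K∈D : D K) (g₁ : LeEmb B K) (g₂ : LeEmb (Tn q (suc m)) K)
          (commutes : ∀ v → fun (emb g₁) (fun (emb f₁) v) ≡ fun (emb g₂) (inj₂ v)) where

          top : Fin (suc m) → V K
          top i = fun (emb g₂) (inj₁ i)

          top-edge⇒ : ∀ i {y} → E K (top i) y → ∃ λ j → fun (emb g₁) (fun (emb f₁) (j , [])) ≡ y
          top-edge⇒ i = map₂ (trans (commutes _)) ∘ to (Tn-children g₂ i)

          -- Every top has as children the roots of the q glued trees, and in A these are the
          -- children of `x`. So each top looks at B exactly as `x` does.
          top-edge : ∀ i b → E K (top i) (fun (emb g₁) b) ⇔ E A x (fun (emb e) b)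
          top-edge i b = mk⇔
            (λ t → let j , eq = top-edge⇒ i t in
              subst (E A x) (trans (sym (e∘f₁ _)) (cong (fun (emb e)) (inj (emb g₁) eq))) (child-edge x j))
            (λ t → let j , eq = edge⇒child t in
              from (Tn-children g₂ i) (j , trans (sym (commutes _))
                (cong (fun (emb g₁)) (inj (emb e) (trans (e∘f₁ _) eq)))))

          -- If every top were glued to a vertex of B, these would be `suc m` distinct twins of `x`
          -- in B, which the maximality of m forbids.
          new-top : ∃ λ i → ¬ Image (emb g₁) (top i)
          new-top with em {∃ λ i → ¬ Image (emb g₁) (top i)}
          ... | yes new = new
          ... | no ¬new = ⊥-elim (no-more-twins (b , b-inj , twins))
            where
            old : ∀ i → Image (emb g₁) (top i)
            old i = decidable-stable em λ ¬old → ¬new (i , ¬old)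
            b : Fin (suc m) → V B
            b i = proj₁ (old i)
            g₁b : ∀ i → fun (emb g₁) (b i) ≡ top i
            g₁b i = proj₂ (old i)
            b-inj : Inj b
            b-inj {i} {j} eq = inj₁-injective (inj (emb g₂) (trans (sym (g₁b i)) (trans (cong (fun (emb g₁)) eq) (g₁b j))))
            b-edge : ∀ i c → E A (fun (emb e) (b i)) (fun (emb e) c) ⇔ E A x (fun (emb e) c)
            b-edge i c = mk⇔
              (λ t → to (top-edge i c) (subst (λ y → E K y _) (g₁b i)
                (to (edge (emb g₁) _ _) (from (edge (emb e) _ _) t))))
              (λ t → to (edge (emb e) _ _) (from (edge (emb g₁) _ _)
                (subst (λ y → E K y _) (sym (g₁b i)) (from (top-edge i c) t))))
            twins : ∀ i → Twin (fun (emb e) (b i)) x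
            twins i = mk⇔
              (λ t → let c , eq = image-edge e (b i , refl) t in
                subst (E A x) eq (to (b-edge i c) (subst (E A _) (sym eq) t)))
              (λ t → let j , eq = edge⇒child t ; c , eq′ = children∈P j ; eq″ = trans eq′ eq in
                subst (E A _) eq″ (from (b-edge i c) (subst (E A x) (sym eq″) t)))

          i : Fin (suc m)
          i = proj₁ new-top

          intoK : Maybe (V B) → V K
          intoK = maybe′ (fun (emb g₁)) (top i)

          intoA : Maybe (V B) → V A
          intoA = maybe′ (fun (emb e)) x

          -- Here `nothing` is the added vertex. Adjacency is pulled back from K, which puts the
          -- digraph in `D`; `same-edges` then identifies it with the adjacency of B with `x` in A.
          B⁺ : Digraph
          B⁺ = record { V = Maybe (V B) ; E = λ u v → E K (intoK u) (intoK v) }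

          B⁺≤K : LeEmb B⁺ K
          B⁺≤K = mkLeEmb record
            { fun  = intoK
            ; inj  = λ { {just _}  {just _}  eq → cong just (inj (emb g₁) eq)
                       ; {just b}  {nothing} eq → ⊥-elim (proj₂ new-top (b , eq))
                       ; {nothing} {just b}  eq → ⊥-elim (proj₂ new-top (b , sym eq))
                       ; {nothing} {nothing} _  → refl }
            ; edge = λ _ _ → mk⇔ id id
            } λ { {just b}  t → let b′ , eq = image-edge g₁ (b , refl) t in just b′ , eq
                ; {nothing} t → let j , eq = top-edge⇒ i t in just _ , eq }

          B⁺-generators : ∀ v → Any (λ g → Reach B⁺ g v) (nothing ∷ map just (proj₁ (finGen B (part∈D P))))
          B⁺-generators nothing  = here ε
          B⁺-generators (just b) = there (map⁺ (Any.map
            (gmap just (to (edge (emb g₁) _ _)) ∘ desc⇒reach)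
            (to (proj₂ (finGen B (part∈D P)) b) tt)))

          B⁺≤A : LeEmb B⁺ A
          B⁺≤A = mkLeEmb record
            { fun  = intoA
            ; inj  = λ { {just _}  {just _}  eq → cong just (inj (emb e) eq)
                       ; {just b}  {nothing} eq → ⊥-elim (x∉P (b , eq))
                       ; {nothing} {just b}  eq → ⊥-elim (x∉P (b , sym eq))
                       ; {nothing} {nothing} _  → refl }
            ; edge = same-edges
            } λ { {just b}  t → let b′ , eq = image-edge e (b , refl) t in just b′ , eq
                ; {nothing} t → let j , eq = edge⇒child t ; b , eq′ = children∈P j in just b , trans eq′ eq }
            where
            same-edges : ∀ u v → E K (intoK u) (intoK v) ⇔ E A (intoA u) (intoA v)
            same-edges (just b) (just c) = mk⇔
              (to (edge (emb e) b c) ∘ from (edge (emb g₁) b c))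
              (to (edge (emb g₁) b c) ∘ from (edge (emb e) b c))
            -- Both sides are impossible: B is closed in K and in A, and the added vertex lies
            -- outside it in either. In the last case a loop would put the added vertex among its
            -- own children, which belong to B.
            same-edges (just b) nothing = mk⇔
              (λ t → ⊥-elim (proj₂ new-top (image-edge g₁ (b , refl) t)))
              (λ t → ⊥-elim (x∉P (image-edge e (b , refl) t)))
            same-edges nothing (just c) = top-edge i c
            same-edges nothing nothing = mk⇔
              (λ t → let j , eq = top-edge⇒ i t in ⊥-elim (proj₂ new-top (_ , eq)))
              (λ t → let j , eq = edge⇒child t ; b , eq′ = children∈P j in ⊥-elim (x∉P (b , trans eq′ eq)))

          extended : Part
          extended = record { part∈D = subdigraph∈D K∈D B⁺≤K _ B⁺-generators ; incl = B⁺≤A }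

        extension : Σ Part λ Q → P ⊑ Q × Contains Q x
        extension
          with m , twins , no-more-twins ← maximal
          with f₁ , e∘f₁ ← factor lower e lower-in-part
          with K , K∈D , g₁ , g₂ , commutes ← amalg (Forest q q) B (Tn q (suc m))
                 (Forest∈D q) (part∈D P) (suc-twins∈D twins) f₁ Tn-lower
          = Amalgam.extended no-more-twins f₁ e∘f₁ K K∈D g₁ g₂ commutes
          , (λ (b , eq) → just b , eq) , nothing , refl

      add : ∀ P x → (∀ i → Contains P (child x i)) → Σ Part λ Q → P ⊑ Q × Contains Q x
      add P x children∈P with em {Contains P x}
      ... | yes x∈P = P , id , x∈P
      ... | no  x∉P = AddVertex.extension P x x∉P children∈P

      -- Recursion on `Near` handles all children before `x`. Parts only grow, so a child already
      -- reached stays contained while its siblings are treated.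
      fill : ∀ {S x} → Near S x → ∀ P → (∀ {v} → S v → Contains P v) → Σ Part λ Q → P ⊑ Q × Contains Q x
      fill (here s) P S⊆P = P , id , S⊆P s
      fill {S} {x} (step h) P S⊆P =
        let Q , P⊑Q , all = fillChildren (allFin q) P S⊆P
            R , Q⊑R , x∈R = add Q x (λ i → All.lookup all (∈-allFin i))
        in R , Q⊑R ∘ P⊑Q , x∈R
        where
        fillChildren : ∀ is P → (∀ {v} → S v → Contains P v) →
          Σ Part λ Q → P ⊑ Q × All (λ i → Contains Q (child x i)) is
        fillChildren []       P S⊆P = P , id , []
        fillChildren (i ∷ is) P S⊆P
          with Q , P⊑Q , i∈Q ← fill (h i) P S⊆P
          with R , Q⊑R , all ← fillChildren is Q (P⊑Q ∘ S⊆P)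
          = R , Q⊑R ∘ P⊑Q , Q⊑R i∈Q ∷ all

      fillAll : ∀ {S F} → All (Near S) F → ∀ P → (∀ {v} → S v → Contains P v) →
        Σ Part λ Q → P ⊑ Q × All (Contains Q) F
      fillAll []          P S⊆P = P , id , []
      fillAll (near ∷ ns) P S⊆P
        with Q , P⊑Q , x∈Q ← fill near P S⊆P
        with R , Q⊑R , all ← fillAll ns Q (P⊑Q ∘ S⊆P)
        = R , Q⊑R ∘ P⊑Q , Q⊑R x∈Q ∷ all

      C⇒D : D A
      C⇒D
        with L , ind , near ← skeleton (proj₂ (proj₂ cA)) generators
        -- The starting part is the forest on the skeleton, which covers the set generated by `L`.
        with Q , _ , all ← fillAll near
               record { part∈D = Forest∈D (length L)
                      ; incl   = forestEmb (lookup L) (independent-lookup ind) }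
               (λ s → let w , eq = reach⇒act (lookup-index s) in (index s , w) , eq)
        = isoClosed (part Q) A (part∈D Q) record
            { emb  = emb (incl Q)
            -- The final part is closed and contains the generators of A, so it is all of A.
            ; surj = λ v → let a , a∈F , r = find (generated v) in image-closed (incl Q) (All.lookup all a∈F) r }

    -- The threshold and the two cases

    classification : (∀ A → D A ⇔ C q A) ⊎ Σ ℕ (λ n → 2 ≤ n × (∀ A → D A ⇔ Cn q n A))
    classification with em {∃ λ m → ¬ D (Tn q (suc m))}
    ... | no ¬∃ = inj₁ λ A → mk⇔ (D⊆C A) λ cA → C⇒D A cA λ m _ →
            decidable-stable em λ ¬d → ¬∃ (m , ¬d)
    ... | yes (N , ¬d) with m , d , ¬d′ ← last-true {λ m → D (Tn q (suc m))} em T₁∈D N ¬d =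
            -- The threshold lies between `suc m` tops, which are in the class, and `2 + m` tops,
            -- which are not.
            inj₂ (2 + m , s≤s (s≤s z≤n) , λ A → mk⇔
              (λ dA → D⊆C A dA , λ f → ¬d′ (Tn∈D dA f))
              -- For k at most m, dropping tops embeds the smaller digraph in the one with `suc m`
              -- tops. For larger k, dropping tops would embed the excluded digraph in A.
              (λ (cA , T≰A) → C⇒D A cA λ k f → case k ≤? m of λ
                { (yes k≤m) → Tn∈D d (Branching.restrict q _ (proj₁ (D⊆C _ d)) i₀ k≤m leEmb-id)
                ; (no  k≰m) → ⊥-elim (T≰A (Branching.restrict q A (proj₁ cA) i₀ (≰⇒> k≰m) f)) }))

theorem3p8 : (∀ {ℓ} → ExcludedMiddle ℓ) →
    (q : ℕ) → 2 ≤ q →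
    (D : Class) → AmalgamationClass D →
    (∀ A → D A → C q A) → D (Tree q) →
    (∀ A → D A ⇔ C q A)
    ⊎ Σ ℕ (λ n → 2 ≤ n × (∀ A → D A ⇔ Cn q n A))
theorem3p8 em (suc (suc q)) (s≤s (s≤s z≤n)) =
  Classical.Amalgamation.classification em (suc (suc q)) zero (suc zero) λ ()
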